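{- Every connected locally connected $\{K_1+P_4,\,K_{1,4},\,K_2+(K_1\cup K_2)\}$-free graph of order at least $3$ that is distinct from (i.e. not isomorphic to) $K_{1,1,3}$ is fully cycle extendable.
   Context: All graphs are finite, simple, and undirected. $n(G)$ is the order of $G$; $N_G(u)$ is the (open) neighborhood of $u$ in $G$. $G$ is locally connected if for every vertex $u$ of $G$ the induced subgraph $G[N_G(u)]$ is connected. For disjoint graphs $G,H$, $G\cup H$ is their disjoint union and $G+H$ their join (all edges between $G$ and $H$ are added to $G\cup H$); $K_n$ and $P_n$ are the complete graph and the path of order $n$, $\bar{G}$ is the complement of $G$, $K_{1,4}=K_1+\bar{K}_4$ is the star of order $5$, and $K_{1,1,3}=K_1+K_1+\bar{K}_3$. For a set ${\cal F}$ of graphs, a graph is ${\cal F}$-free if it contains no graph in ${\cal F}$ as an induced subgraph (up to isomorphism). A cycle $C$ in $G$ is extendable if $G$ contains a cycle $C'$ of order $n(C)+1$ with $V(C)\subseteq V(C')$. $G$ is fully cycle extendable if every vertex of $G$ lies on a triangle and every cycle in $G$ of order less than $n(G)$ is extendable. -}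

module Defs where

open import Data.Bool using (Bool; true; false; not; _∧_; _∨_; T)
open import Data.Bool.Properties using (T-irrelevant; ∨-comm)
open import Data.Fin using (Fin; toℕ)
import Data.Fin.Properties as Fin
open import Data.List using (List; _∷_; _∷ʳ_; length)
open import Data.List.Membership.Propositional using (_∈_)
open import Data.List.Relation.Binary.Subset.Propositional using (_⊆_)
open import Data.List.Relation.Unary.All using (All)
open import Data.List.Relation.Unary.Linked using (Linked)
open import Data.List.Relation.Unary.Unique.Propositional using (Unique)
open import Data.Nat using (ℕ; zero; suc; _≤_; _<_; _≡ᵇ_)
open import Data.Product using (Σ; ∃-syntax; _×_; proj₁)
import Data.Product.Properties as Product
open import Data.Sum using (_⊎_; inj₁; inj₂)
import Data.Sum.Properties as Sum
open import Function using (_∘_; _↔_; Inverse)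
open import Relation.Binary.Construct.Closure.ReflexiveTransitive using (Star)
open import Relation.Binary.Definitions using (DecidableEquality)
open import Relation.Binary.PropositionalEquality
  using (_≡_; refl; sym; cong; cong₂)
open import Relation.Nullary using (¬_; yes; no; does; contradiction)

-- Simple undirected graphs.  Adjacency is Boolean so that T (adj u v) is
-- decidable and proof-irrelevant; in particular each neighbour of u gives
-- exactly one vertex of the subgraph induced by the neighbourhood of u.
record Graph : Set₁ where
  field
    Vertex      : Set
    _≟_         : DecidableEquality Vertex
    adj         : Vertex → Vertex → Bool
    symmetric   : ∀ u v → adj u v ≡ adj v u
    irreflexive : ∀ v → adj v v ≡ false

  Adj : Vertex → Vertex → Set
  Adj u v = T (adj u v)

  N : Vertex → Vertex → Bool
  N u = adj u

record FiniteGraph : Set₁ where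
  field
    graph : Graph
    order : ℕ
    enum  : Graph.Vertex graph ↔ Fin order

  open Graph graph public

infix 4 _≅_

record _≅_ (G H : Graph) : Set where
  private
    module G = Graph G
    module H = Graph H
  field
    bijection : G.Vertex ↔ H.Vertex
  open Inverse bijection using (to)
  field
    preserves : ∀ u v → H.adj (to u) (to v) ≡ G.adj u v

private
  does-≟-sym : ∀ {A : Set} (_≟_ : DecidableEquality A) x y →
               does (x ≟ y) ≡ does (y ≟ x)
  does-≟-sym _≟_ x y with x ≟ y | y ≟ x
  ... | yes _ | yes _ = refl
  ... | no  _ | no  _ = refl
  ... | yes p | no ¬q = contradiction (sym p) ¬q
  ... | no ¬p | yes q = contradiction (sym q) ¬p

  does-≟-refl : ∀ {A : Set} (_≟_ : DecidableEquality A) x → does (x ≟ x) ≡ true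
  does-≟-refl _≟_ x with x ≟ x
  ... | yes _ = refl
  ... | no ¬p = contradiction refl ¬p

  suc≢ᵇ : ∀ n → (suc n ≡ᵇ n) ≡ false
  suc≢ᵇ zero    = refl
  suc≢ᵇ (suc n) = suc≢ᵇ n

infixl 10 _[_]

_[_] : (G : Graph) → (Graph.Vertex G → Bool) → Graph
G [ S ] = record
  { Vertex      = Σ G.Vertex (T ∘ S)
  ; _≟_         = Product.≡-dec G._≟_ (λ p q → yes (T-irrelevant p q))
  ; adj         = λ u v → G.adj (proj₁ u) (proj₁ v)
  ; symmetric   = λ u v → G.symmetric (proj₁ u) (proj₁ v)
  ; irreflexive = λ v → G.irreflexive (proj₁ v)
  }
  where module G = Graph G

K : ℕ → Graph
K n = record
  { Vertex      = Fin n
  ; _≟_         = Fin._≟_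
  ; adj         = λ i j → not (does (i Fin.≟ j))
  ; symmetric   = λ i j → cong not (does-≟-sym Fin._≟_ i j)
  ; irreflexive = λ i → cong not (does-≟-refl Fin._≟_ i)
  }

P : ℕ → Graph
P n = record
  { Vertex      = Fin n
  ; _≟_         = Fin._≟_
  ; adj         = λ i j → (suc (toℕ i) ≡ᵇ toℕ j) ∨ (suc (toℕ j) ≡ᵇ toℕ i)
  ; symmetric   = λ i j → ∨-comm (suc (toℕ i) ≡ᵇ toℕ j) (suc (toℕ j) ≡ᵇ toℕ i)
  ; irreflexive = λ i → cong₂ _∨_ (suc≢ᵇ (toℕ i)) (suc≢ᵇ (toℕ i))
  }

complement : Graph → Graph
complement G = record
  { Vertex      = G.Vertex
  ; _≟_         = G._≟_
  ; adj         = λ u v → not (does (u G.≟ v)) ∧ not (G.adj u v)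
  ; symmetric   = λ u v → cong₂ (λ a b → not a ∧ not b)
                            (does-≟-sym G._≟_ u v) (G.symmetric u v)
  ; irreflexive = λ v → cong (λ a → not a ∧ not (G.adj v v))
                          (does-≟-refl G._≟_ v)
  }
  where module G = Graph G

private
  sumGraph : Bool → Graph → Graph → Graph
  sumGraph cross G H = record
    { Vertex      = G.Vertex ⊎ H.Vertex
    ; _≟_         = Sum.≡-dec G._≟_ H._≟_
    ; adj         = λ where
        (inj₁ u) (inj₁ v) → G.adj u v
        (inj₁ _) (inj₂ _) → cross
        (inj₂ _) (inj₁ _) → cross
        (inj₂ u) (inj₂ v) → H.adj u v
    ; symmetric   = λ where
        (inj₁ u) (inj₁ v) → G.symmetric u v
        (inj₁ _) (inj₂ _) → refl
        (inj₂ _) (inj₁ _) → refl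
        (inj₂ u) (inj₂ v) → H.symmetric u v
    ; irreflexive = λ where
        (inj₁ v) → G.irreflexive v
        (inj₂ v) → H.irreflexive v
    }
    where
    module G = Graph G
    module H = Graph H

infixr 6 _∪_ _+_

-- Disjoint union.
_∪_ : Graph → Graph → Graph
_∪_ = sumGraph false

-- Join.
_+_ : Graph → Graph → Graph
_+_ = sumGraph true

K₁,₄ : Graph
K₁,₄ = K 1 + complement (K 4)

K₁,₁,₃ : Graph
K₁,₁,₃ = K 1 + K 1 + complement (K 3)

Connected : Graph → Set
Connected G = ∀ u v → Star Adj u v
  where open Graph G

LocallyConnected : Graph → Set
LocallyConnected G = ∀ u → Connected (G [ N u ])
  where open Graph G

_-free : List Graph → Graph → Set₁
(𝓕 -free) G = All (λ H → ¬ (∃[ S ] G [ S ] ≅ H)) 𝓕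

-- A cycle is given by a traversal: distinct vertices v₁, …, vₖ with k ≥ 3 such
-- that consecutive entries of v₁, …, vₖ, v₁ are adjacent.
record Cycle (G : Graph) : Set where
  open Graph G
  field
    start : Vertex
    rest  : List Vertex

  vertices : List Vertex
  vertices = start ∷ rest

  size : ℕ
  size = length vertices

  field
    3≤size : 3 ≤ size
    distinct : Unique vertices
    closed   : Linked Adj (vertices ∷ʳ start)

module _ {G : Graph} where
  open Cycle

  Extendable : Cycle G → Set
  Extendable C = ∃[ C′ ] size C′ ≡ suc (size C) × vertices C ⊆ vertices {G} C′

LiesOnTriangle : (G : Graph) → Graph.Vertex G → Set
LiesOnTriangle G u = ∃[ C ] size C ≡ 3 × u ∈ vertices {G} C
  where open Cycle

FullyCycleExtendable : FiniteGraph → Set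
FullyCycleExtendable G =
  (∀ u → LiesOnTriangle graph u) ×
  (∀ (C : Cycle graph) → Cycle.size C < order → Extendable C)
  where open FiniteGraph G

{-# OPTIONS --safe #-}

-- A connected graph without induced P₄ and paw K₁ + (K₁ ∪ K₂) is complete
-- multipartite, i.e. every vertex sees an end of every edge.  The hypotheses
-- make each neighbourhood such a graph, and then G itself contains neither
-- P₄ nor the paw, so G is complete multipartite too; K₁,₄-freeness bounds its
-- parts by 3.  A vertex x outside a cycle C can be inserted into C unless
-- exactly every other vertex of C lies in the part of x, which forces C to be
-- a 4-cycle a b c d with part {a , c , x}.  If b ≁ d, a common neighbour of a
-- and b can be inserted; if b ∼ d, any further vertex can, and there is one
-- because G ≇ K₁,₁,₃.

module Submission where

open import Defs
open import Data.Bool using (Bool; true; false; T)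
import Data.Bool.Properties as Bool
open import Data.Empty using (⊥)
open import Data.Fin using (Fin; zero; suc)
open import Data.Fin.Patterns using (0F; 1F; 2F; 3F)
import Data.Fin.Properties as Fin
open import Data.List using (List; _∷_; []; _∷ʳ_; length; lookup)
open import Data.List.Membership.Propositional using (_∈_; _∉_)
import Data.List.Membership.DecPropositional as DecMembership
open import Data.List.Membership.Propositional.Properties using (∈-lookup)
import Data.List.Membership.Setoid.Properties as Membership
open import Data.List.Relation.Binary.Permutation.Propositional
  using (_↭_; ↭-refl; ↭-prep; ↭-swap; ↭-trans; ↭-sym; ↭⇒↭ₛ)
open import Data.List.Relation.Binary.Permutation.Propositional.Properties
  using (↭-length; ∈-resp-↭; ∷↭∷ʳ)
import Data.List.Relation.Binary.Permutation.Setoid.Properties as Permutation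
open import Data.List.Relation.Unary.All as All using (All; []; _∷_)
open import Data.List.Relation.Unary.All.Properties using (¬Any⇒All¬)
open import Data.List.Relation.Unary.AllPairs using (AllPairs; []; _∷_)
open import Data.List.Relation.Unary.Any as Any using (here; there)
open import Data.List.Relation.Unary.Unique.Propositional using (Unique)
open import Data.List.Relation.Unary.Linked using (Linked; [-]; _∷_)
open import Data.Nat using (_≤_; _<_; z≤n; s≤s)
import Data.Nat.Properties as ℕ
open import Data.Product using (∃-syntax; _×_; _,_; proj₁; proj₂; curry)
open import Data.Sum using (_⊎_; inj₁; inj₂; [_,_]′)
open import Data.Unit using (tt)
open import Function using (_∘_; id; Inverse; mk↔ₛ′)
open import Relation.Binary.Construct.Closure.ReflexiveTransitive using (Star; ε; _◅_)
open import Relation.Binary.PropositionalEquality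
  using (_≡_; _≢_; refl; sym; trans; cong; subst; setoid)
open import Relation.Nullary using (¬_; Dec; yes; no; contradiction)
open import Relation.Nullary.Decidable
  using (⌊_⌋; toWitness; fromWitness; from-yes; map′; _⊎-dec_; _×-dec_; _→-dec_)

-- Induced copies

-- Decidability of the image is part of the data because `_[_]` takes a Boolean vertex set: the
-- image can then serve as the set that induces a copy of `H`.
record Embedding (H G : Graph) : Set where
  private
    module H = Graph H
    module G = Graph G
  field
    apply     : H.Vertex → G.Vertex
    injective : ∀ {i j} → apply i ≡ apply j → i ≡ j
    preserves : ∀ i j → G.adj (apply i) (apply j) ≡ H.adj i j
    image?    : ∀ v → Dec (∃[ i ] apply i ≡ v)

  surjective⇒≅ : (∀ v → ∃[ i ] apply i ≡ v) → G ≅ H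
  surjective⇒≅ onto = record
    { bijection = mk↔ₛ′ (proj₁ ∘ onto) apply
        (λ i → injective (proj₂ (onto (apply i)))) (proj₂ ∘ onto)
    ; preserves = λ u v → trans (sym (preserves _ _))
        (trans (cong (λ w → G.adj w _) (proj₂ (onto u)))
               (cong (G.adj u) (proj₂ (onto v))))
    }

open Embedding

embedding⇒induced : ∀ {H G} → Embedding H G → ∃[ S ] G [ S ] ≅ H
embedding⇒induced {H} {G} e = S , surjective⇒≅ e′ onto
  where
  S : Graph.Vertex G → Bool
  S v = ⌊ image? e v ⌋

  ≡-in-S : ∀ {u v : Graph.Vertex (G [ S ])} → proj₁ u ≡ proj₁ v → u ≡ v
  ≡-in-S {_ , p} {_ , q} refl = cong (_ ,_) (Bool.T-irrelevant p q)

  e′ : Embedding H (G [ S ])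
  e′ = record
    { apply     = λ i → apply e i , fromWitness (i , refl)
    ; injective = λ eq → injective e (cong proj₁ eq)
    ; preserves = preserves e
    ; image?    = λ v → map′ (λ (i , eq) → i , ≡-in-S eq)
                            (λ (i , eq) → i , cong proj₁ eq)
                            (image? e (proj₁ v))
    }

  onto : ∀ v → ∃[ i ] apply e′ i ≡ v
  onto (v , p) with i , eq ← toWitness {a? = image? e v} p = i , ≡-in-S eq

module Basics (G : Graph) where
  open Graph G public

  adj-sym : ∀ {u v} → Adj u v → Adj v u
  adj-sym {u} {v} = subst T (symmetric u v)

  adj⇒≢ : ∀ {u v} → Adj u v → u ≢ v
  adj⇒≢ {u} uv refl = subst T (irreflexive u) uv

  separated : ∀ {u v w} → Adj w u → ¬ Adj w v → u ≢ v
  separated wu ¬wv refl = ¬wv wu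

  adj? : ∀ u v → Dec (Adj u v)
  adj? u v = Bool.T? (adj u v)

  -- A walk from `v` to `w` inside the neighbourhood of `u` is nonempty because `v ≢ w`, and its
  -- first step leads to the desired vertex.
  common-neighbour : ∀ {u v w} → Connected (G [ N u ]) → Adj u v → Adj u w → v ≢ w →
                     ∃[ z ] Adj u z × Adj v z
  common-neighbour {u} {v} {w} conn uv uw v≢w = first-step (conn (v , uv) (w , uw)) v≢w
    where
    first-step : ∀ {s t} → Star (Graph.Adj (G [ N u ])) s t → proj₁ s ≢ proj₁ t →
                 ∃[ z ] Adj u z × Adj (proj₁ s) z
    first-step ε                        s≢t = contradiction refl s≢t
    first-step (_◅_ {j = z , uz} sz _) _   = z , uz , sz

  adj≡true : ∀ {u v} → Adj u v → adj u v ≡ true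
  adj≡true {u} {v} uv with true ← adj u v = refl

  adj≡false : ∀ {u v} → ¬ Adj u v → adj u v ≡ false
  adj≡false {u} {v} ¬uv with adj u v
  ... | false = refl
  ... | true  = contradiction tt ¬uv

module Embeddings (G : Graph) where
  open Basics G

  module _ {H₁ H₂ : Graph} (e₁ : Embedding H₁ G) (e₂ : Embedding H₂ G) where
    private
      ⊎-apply : Graph.Vertex H₁ ⊎ Graph.Vertex H₂ → Vertex
      ⊎-apply = [ apply e₁ , apply e₂ ]′

      ⊎-injective : (∀ i j → apply e₁ i ≢ apply e₂ j) →
                    ∀ {i j} → ⊎-apply i ≡ ⊎-apply j → i ≡ j
      ⊎-injective ≢ {inj₁ i} {inj₁ j} eq = cong inj₁ (injective e₁ eq)
      ⊎-injective ≢ {inj₁ i} {inj₂ j} eq = contradiction eq (≢ i j)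
      ⊎-injective ≢ {inj₂ i} {inj₁ j} eq = contradiction (sym eq) (≢ j i)
      ⊎-injective ≢ {inj₂ i} {inj₂ j} eq = cong inj₂ (injective e₂ eq)

      ⊎-image? : ∀ v → Dec (∃[ i ] ⊎-apply i ≡ v)
      ⊎-image? v = map′
        [ (λ (i , eq) → inj₁ i , eq) , (λ (i , eq) → inj₂ i , eq) ]′
        (λ { (inj₁ i , eq) → inj₁ (i , eq) ; (inj₂ i , eq) → inj₂ (i , eq) })
        (image? e₁ v ⊎-dec image? e₂ v)

    join : (∀ i j → Adj (apply e₁ i) (apply e₂ j)) → Embedding (H₁ + H₂) G
    join cross = record
      { apply     = ⊎-apply
      ; injective = ⊎-injective (λ i j → adj⇒≢ (cross i j))
      ; preserves = λ where
          (inj₁ i) (inj₁ j) → preserves e₁ i j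
          (inj₁ i) (inj₂ j) → adj≡true (cross i j)
          (inj₂ i) (inj₁ j) → adj≡true (adj-sym (cross j i))
          (inj₂ i) (inj₂ j) → preserves e₂ i j
      ; image?    = ⊎-image?
      }

    union : (∀ i j → apply e₁ i ≢ apply e₂ j × ¬ Adj (apply e₁ i) (apply e₂ j)) →
            Embedding (H₁ ∪ H₂) G
    union cross = record
      { apply     = ⊎-apply
      ; injective = ⊎-injective (λ i j → proj₁ (cross i j))
      ; preserves = λ where
          (inj₁ i) (inj₁ j) → preserves e₁ i j
          (inj₁ i) (inj₂ j) → adj≡false (proj₂ (cross i j))
          (inj₂ i) (inj₁ j) → adj≡false (proj₂ (cross j i) ∘ adj-sym)
          (inj₂ i) (inj₂ j) → preserves e₂ i j
      ; image?    = ⊎-image?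
      }

  vertex : Vertex → Embedding (K 1) G
  vertex v = record
    { apply     = λ _ → v
    ; injective = λ { {0F} {0F} _ → refl }
    ; preserves = λ { 0F 0F → irreflexive v }
    ; image?    = λ w → Fin.any? (λ _ → v ≟ w)
    }

  edge : ∀ {u v} → Adj u v → Embedding (K 2) G
  edge {u} {v} uv = record
    { apply     = f
    ; injective = inj _ _
    ; preserves = λ where
        0F 0F → irreflexive u
        0F 1F → adj≡true uv
        1F 0F → adj≡true (adj-sym uv)
        1F 1F → irreflexive v
    ; image?    = λ w → Fin.any? (λ i → f i ≟ w)
    }
    where
    f : Fin 2 → Vertex
    f 0F = u
    f 1F = v

    inj : ∀ i j → f i ≡ f j → i ≡ j
    inj 0F 0F _  = refl
    inj 0F 1F eq = contradiction eq (adj⇒≢ uv)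
    inj 1F 0F eq = contradiction (sym eq) (adj⇒≢ uv)
    inj 1F 1F _  = refl

  -- Distinctness of the four vertices follows from the adjacencies: vertices with equal images have
  -- the same neighbours in P₄, and P₄ has no two such vertices, which `twin-free` settles by a
  -- finite check.
  path₄ : ∀ {a b c d} → Adj a b → Adj b c → Adj c d →
          ¬ Adj a c → ¬ Adj b d → ¬ Adj a d → Embedding (P 4) G
  path₄ {a} {b} {c} {d} ab bc cd ¬ac ¬bd ¬ad = record
    { apply     = f
    ; injective = λ {i} {j} eq → twin-free i j
        (λ k → trans (sym (pres i k))
                     (trans (cong (λ v → adj v (f k)) eq) (pres j k)))
    ; preserves = pres
    ; image?    = λ w → Fin.any? (λ i → f i ≟ w)
    }
    where
    f : Fin 4 → Vertex
    f 0F = a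
    f 1F = b
    f 2F = c
    f 3F = d

    pres : ∀ i j → adj (f i) (f j) ≡ Graph.adj (P 4) i j
    pres 0F 0F = irreflexive a
    pres 0F 1F = adj≡true ab
    pres 0F 2F = adj≡false ¬ac
    pres 0F 3F = adj≡false ¬ad
    pres 1F 0F = adj≡true (adj-sym ab)
    pres 1F 1F = irreflexive b
    pres 1F 2F = adj≡true bc
    pres 1F 3F = adj≡false ¬bd
    pres 2F 0F = adj≡false (¬ac ∘ adj-sym)
    pres 2F 1F = adj≡true (adj-sym bc)
    pres 2F 2F = irreflexive c
    pres 2F 3F = adj≡true cd
    pres 3F 0F = adj≡false (¬ad ∘ adj-sym)
    pres 3F 1F = adj≡false (¬bd ∘ adj-sym)
    pres 3F 2F = adj≡true (adj-sym cd)
    pres 3F 3F = irreflexive d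

    twin-free : ∀ i j → (∀ k → Graph.adj (P 4) i k ≡ Graph.adj (P 4) j k) → i ≡ j
    twin-free = from-yes (Fin.all? λ i → Fin.all? λ j →
      Fin.all? (λ k → Graph.adj (P 4) i k Bool.≟ Graph.adj (P 4) j k)
        →-dec (i Fin.≟ j))

  Independent : List Vertex → Set
  Independent = AllPairs (λ u v → u ≢ v × ¬ Adj u v)

  independent-lookup : ∀ {vs} → Independent vs → ∀ {i j} → i ≢ j →
                       lookup vs i ≢ lookup vs j × ¬ Adj (lookup vs i) (lookup vs j)
  independent-lookup (p ∷ ps) {zero}  {zero}  i≢j = contradiction refl i≢j
  independent-lookup (p ∷ ps) {zero}  {suc j} i≢j = All.lookup p (∈-lookup j)
  independent-lookup (p ∷ ps) {suc i} {zero}  i≢j =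
    let ≢ , ¬e = All.lookup p (∈-lookup i) in ≢ ∘ sym , ¬e ∘ adj-sym
  independent-lookup (p ∷ ps) {suc i} {suc j} i≢j =
    independent-lookup ps (i≢j ∘ cong suc)

  independent : ∀ {vs} → Independent vs → Embedding (complement (K (length vs))) G
  independent {vs} ind = record
    { apply     = lookup vs
    ; injective = inj _ _
    ; preserves = pres
    ; image?    = λ w → Fin.any? (λ i → lookup vs i ≟ w)
    }
    where
    inj : ∀ i j → lookup vs i ≡ lookup vs j → i ≡ j
    inj i j eq with i Fin.≟ j
    ... | yes i≡j = i≡j
    ... | no  i≢j = contradiction eq (proj₁ (independent-lookup ind i≢j))

    pres : ∀ i j → adj (lookup vs i) (lookup vs j) ≡
                   Graph.adj (complement (K (length vs))) i j
    pres i j with i Fin.≟ j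
    ... | yes refl = irreflexive (lookup vs i)
    ... | no  i≢j  = adj≡false (proj₂ (independent-lookup ind i≢j))

-- Complete multipartite graphs

module _ (G : Graph) where
  open Basics G

  CompleteMultipartite : Set
  CompleteMultipartite = ∀ {u v} → Adj u v → ∀ w → Adj w u ⊎ Adj w v

  P₄-Free : Set
  P₄-Free = ∀ {a b c d} → Adj a b → Adj b c → Adj c d →
            ¬ Adj a c → ¬ Adj b d → ¬ Adj a d → ⊥

  PawFree : Set
  PawFree = ∀ {h a b c} → Adj h a → Adj h b → Adj h c →
            Adj a b → ¬ Adj c a → ¬ Adj c b → ⊥

  -- Seeing an end of the edge `uv` propagates backwards along a walk from `w` to `u`. If `w′` sees
  -- `u` but its neighbour `w` sees neither end, then `w′`, `u`, `v`, `w` form a paw centred at `w′`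
  -- when `w′` sees `v`, and an induced path `w w′ u v` otherwise.
  completeMultipartite : Connected G → P₄-Free → PawFree → CompleteMultipartite
  completeMultipartite conn p₄ paw {u} {v} uv w = walk (conn w u)
    where
    step : ∀ {w w′ u v} → Adj u v → Adj w w′ → Adj w′ u → Adj w u ⊎ Adj w v
    step {w} {w′} {u} {v} uv ww′ w′u with adj? w u | adj? w v | adj? w′ v
    ... | yes wu | _      | _       = inj₁ wu
    ... | no _   | yes wv | _       = inj₂ wv
    ... | no ¬wu | no ¬wv | yes w′v =
      contradiction ¬wv (paw w′u w′v (adj-sym ww′) uv ¬wu)
    ... | no ¬wu | no ¬wv | no ¬w′v =
      contradiction ¬wv (p₄ ww′ w′u uv ¬wu ¬w′v)

    walk : ∀ {w} → Star Adj w u → Adj w u ⊎ Adj w v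
    walk ε         = inj₂ uv
    walk (ww′ ◅ p) with walk p
    ... | inj₁ w′u = step uv ww′ w′u
    ... | inj₂ w′v = [ inj₂ , inj₁ ]′ (step (adj-sym uv) ww′ w′v)

-- Consequences of the forbidden subgraphs

module _ (G : Graph) (conn : Connected G) (locConn : LocallyConnected G)
         (free : ((K 1 + P 4 ∷ K₁,₄ ∷ K 2 + (K 1 ∪ K 2) ∷ []) -free) G) where
  open Basics G
  open Embeddings G

  -- Adding `u` to an induced P₄ of its neighbourhood gives K₁ + P₄. Adding `u` to an induced paw
  -- with centre `h` gives K₂ + (K₁ ∪ K₂), with `u` and `h` as the K₂.
  neighbourhood-multipartite : ∀ {u v w} → Adj u v → Adj u w → Adj v w →
                               ∀ {t} → Adj u t → Adj t v ⊎ Adj t w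
  neighbourhood-multipartite {u} uv uw vw {t} ut =
    completeMultipartite (G [ N u ]) (locConn u)
      (λ {a} {b} {c} {d} → p₄ {a} {b} {c} {d})
      (λ {h} {a} {b} {c} → paw {h} {a} {b} {c})
      {_ , uv} {_ , uw} vw (t , ut)
    where
    p₄ : P₄-Free (G [ N u ])
    p₄ {_ , ua} {_ , ub} {_ , uc} {_ , ud} ab bc cd ¬ac ¬bd ¬ad =
      All.head free (embedding⇒induced
        (join (vertex u) (path₄ ab bc cd ¬ac ¬bd ¬ad) λ where
          0F 0F → ua
          0F 1F → ub
          0F 2F → uc
          0F 3F → ud))

    paw : PawFree (G [ N u ])
    paw {_ , uh} {_ , ua} {_ , ub} {_ , uc} ha hb hc ab ¬ca ¬cb =
      All.head (All.tail (All.tail free)) (embedding⇒induced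
        (join (edge uh)
              (union (vertex _) (edge ab) λ where
                0F 0F → separated (adj-sym ab) (¬cb ∘ adj-sym) ∘ sym , ¬ca
                0F 1F → separated ab (¬ca ∘ adj-sym) ∘ sym , ¬cb) λ where
          0F (inj₁ 0F) → uc
          0F (inj₂ 0F) → ua
          0F (inj₂ 1F) → ub
          1F (inj₁ 0F) → hc
          1F (inj₂ 0F) → ha
          1F (inj₂ 1F) → hb))

  -- A paw lies, apart from its centre, in the neighbourhood of that centre, so the local statement
  -- excludes it at once. Only P₄ needs a longer argument.
  multipartite : CompleteMultipartite G
  multipartite = completeMultipartite G conn p₄ paw
    where
    paw : PawFree G
    paw ha hb hc ab ¬ca ¬cb = [ ¬ca , ¬cb ]′ (neighbourhood-multipartite ha hb ab hc)

    -- Let `e` be a common neighbour of `a` and `b`. The edge `ae` in the neighbourhood of `b`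
    -- forces `c` to see `e`. The edge `be` in that of `c` then forces `d` to see `e`. Finally the
    -- edge `ab` in that of `e` forces `d` to see `a` or `b`, which is absurd.
    p₄ : P₄-Free G
    p₄ {a} {b} {c} {d} ab bc cd ¬ac ¬bd ¬ad
      with e , be , ae ← common-neighbour (locConn b) (adj-sym ab) bc (λ { refl → ¬ad cd })
      with neighbourhood-multipartite (adj-sym ab) be ae bc
    ... | inj₁ ca = ¬ac (adj-sym ca)
    ... | inj₂ ce with neighbourhood-multipartite (adj-sym bc) ce be cd
    ...   | inj₁ db = ¬bd (adj-sym db)
    ...   | inj₂ de = [ ¬ad ∘ adj-sym , ¬bd ∘ adj-sym ]′
              (neighbourhood-multipartite (adj-sym ae) (adj-sym be) ab (adj-sym de))

  -- Nonadjacency is thus an equivalence relation, whose classes are the parts.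
  nonadj-trans : ∀ {u v w} → ¬ Adj u v → ¬ Adj v w → ¬ Adj u w
  nonadj-trans ¬uv ¬vw uw = [ ¬uv ∘ adj-sym , ¬vw ]′ (multipartite uw _)

  -- Connectedness gives `a` a neighbour `h`. Every vertex that misses `a` must see the other end
  -- `h` of this edge, so `h` would be the centre of an induced K₁,₄.
  parts≤3 : ∀ {a b c d} → ¬ Independent (a ∷ b ∷ c ∷ d ∷ [])
  parts≤3 {a} {b} {c} {d} ind@(((a≢b , ¬ab) ∷ (_ , ¬ac) ∷ (_ , ¬ad) ∷ []) ∷ _)
    with conn a b
  ... | ε = a≢b refl
  ... | _◅_ {j = h} ah _ = All.head (All.tail free) (embedding⇒induced
          (join (vertex h) (independent ind) λ where
            0F 0F → adj-sym ah
            0F 1F → h∼ ¬ab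
            0F 2F → h∼ ¬ac
            0F 3F → h∼ ¬ad))
    where
    h∼ : ∀ {v} → ¬ Adj a v → Adj h v
    h∼ ¬av = [ (λ va → contradiction (adj-sym va) ¬av) , adj-sym ]′
               (multipartite ah _)

-- Inserting a vertex into a cycle

module Insertion (G : Graph) where
  open Basics G

  NotBoth : Vertex → Vertex → Vertex → Set
  NotBoth x u v = Adj x u → ¬ Adj x v

  both? : ∀ x u v → Dec (Adj x u × Adj x v)
  both? x u v = adj? x u ×-dec adj? x v

  -- The vertex `x` goes into the first edge of the path both of whose ends it sees. The ends `v`
  -- and `t` stay fixed, so taking both to be the start of a cycle treats its closing edge like any
  -- other.
  insert : ∀ x v vs t → Linked Adj (v ∷ vs ∷ʳ t) →
           (∃[ ws ] Linked Adj (v ∷ ws ∷ʳ t) × ws ↭ x ∷ vs) ⊎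
           Linked (NotBoth x) (v ∷ vs ∷ʳ t)
  insert x v [] t (vt ∷ [-]) with both? x v t
  ... | yes (xv , xt) = inj₁ (x ∷ [] , adj-sym xv ∷ xt ∷ [-] , ↭-refl)
  ... | no ¬both      = inj₂ (curry ¬both ∷ [-])
  insert x v (w ∷ vs) t (vw ∷ linked) with both? x v w | insert x w vs t linked
  ... | yes (xv , xw) | _ = inj₁ (x ∷ w ∷ vs , adj-sym xv ∷ xw ∷ linked , ↭-refl)
  ... | no ¬both | inj₂ notBoth = inj₂ (curry ¬both ∷ notBoth)
  ... | no ¬both | inj₁ (ws , linked′ , ws↭) =
    inj₁ (w ∷ ws , vw ∷ linked′ , ↭-trans (↭-prep w ws↭) (↭-swap w x ↭-refl))

  insert⇒extendable : ∀ (C : Cycle G) {x} → x ∉ Cycle.vertices C →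
                      Extendable C ⊎ Linked (NotBoth x) (Cycle.vertices C ∷ʳ Cycle.start C)
  insert⇒extendable C {x} x∉C with insert x start rest start closed
    where open Cycle C
  ... | inj₂ notBoth              = inj₂ notBoth
  ... | inj₁ (ws , closed′ , ws↭) = inj₁ (C′ , ↭-length perm , λ v∈C → ∈-resp-↭ (↭-sym perm) (there v∈C))
    where
    open Cycle C
    perm : start ∷ ws ↭ x ∷ vertices
    perm = ↭-trans (↭-prep start ws↭) (↭-swap start x ↭-refl)

    C′ : Cycle G
    C′ = record
      { start    = start
      ; rest     = ws
      ; 3≤size   = subst (3 ≤_) (sym (↭-length perm)) (ℕ.m≤n⇒m≤1+n 3≤size)
      ; distinct = Permutation.Unique-resp-↭ (setoid Vertex) (↭⇒↭ₛ (↭-sym perm))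
                     (¬Any⇒All¬ vertices x∉C ∷ distinct)
      ; closed   = closed′
      }

-- Vertices outside a given list

module Finite (G : FiniteGraph) where
  open FiniteGraph G
  open DecMembership _≟_ using (_∈?_)
  open Inverse enum using (to; from; strictlyInverseˡ; strictlyInverseʳ)

  cover? : ∀ vs → (∃[ v ] v ∉ vs) ⊎ (∀ v → v ∈ vs)
  cover? vs with Fin.all? (λ i → from i ∈? vs)
  ... | yes all = inj₂ λ v → subst (_∈ vs) (strictlyInverseʳ v) (all (to v))
  ... | no ¬all with i , ∉ ← Fin.¬∀⟶∃¬ order _ (λ i → from i ∈? vs) ¬all = inj₁ (from i , ∉)

  -- If `vs` contained every vertex, sending each vertex to its position in `vs` would inject
  -- `Fin order` into `Fin (length vs)`.
  outside : ∀ vs → length vs < order → ∃[ v ] v ∉ vs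
  outside vs short with cover? vs
  ... | inj₁ out = out
  ... | inj₂ all = contradiction
    (Fin.injective⇒≤ {f = λ i → Any.index (all (from i))} λ {i} {j} eq →
      trans (sym (strictlyInverseˡ i))
        (trans (cong to (Membership.index-injective (setoid Vertex) (all (from i)) (all (from j)) eq))
               (strictlyInverseˡ j)))
    (ℕ.<⇒≱ short)

-- Triangles and cycle extension

module _ (G : FiniteGraph)
         (conn : Connected (FiniteGraph.graph G))
         (locConn : LocallyConnected (FiniteGraph.graph G))
         (free : ((K 1 + P 4 ∷ K₁,₄ ∷ K 2 + (K 1 ∪ K 2) ∷ []) -free) (FiniteGraph.graph G))
         (3≤order : 3 ≤ FiniteGraph.order G) where
  open FiniteGraph G using (graph; order)
  open Basics graph
  open Embeddings graph
  open Insertion graph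
  open Finite G

  private
    M : CompleteMultipartite graph
    M = multipartite graph conn locConn free

    ≁-trans : ∀ {u v w} → ¬ Adj u v → ¬ Adj v w → ¬ Adj u w
    ≁-trans = nonadj-trans graph conn locConn free

  -- A third vertex sees an end of `uv`. That end therefore has two distinct neighbours, and local
  -- connectedness there yields the triangle.
  edge-in-triangle : ∀ {u v} → Adj u v → ∃[ w ] Adj w u × Adj w v
  edge-in-triangle {u} {v} uv with outside (u ∷ v ∷ []) 3≤order
  ... | w , w∉ with M uv w
  ...   | inj₁ wu with z , uz , vz ← common-neighbour (locConn u) uv (adj-sym wu)
                        (λ v≡w → w∉ (there (here (sym v≡w)))) = z , adj-sym uz , adj-sym vz
  ...   | inj₂ wv with z , vz , uz ← common-neighbour (locConn v) (adj-sym uv) (adj-sym wv)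
                        (λ u≡w → w∉ (here (sym u≡w))) = z , adj-sym uz , adj-sym vz

  on-triangle : ∀ u → LiesOnTriangle graph u
  on-triangle u with outside (u ∷ []) (ℕ.≤-trans (s≤s (s≤s z≤n)) 3≤order)
  ... | w , w∉ with conn u w
  ...   | ε = contradiction (here refl) w∉
  ...   | _◅_ {j = v} uv _ with t , tu , tv ← edge-in-triangle uv =
    record
      { start    = u
      ; rest     = v ∷ t ∷ []
      ; 3≤size   = ℕ.≤-refl
      ; distinct = (adj⇒≢ uv ∷ adj⇒≢ (adj-sym tu) ∷ []) ∷ (adj⇒≢ (adj-sym tv) ∷ []) ∷ [] ∷ []
      ; closed   = uv ∷ adj-sym tv ∷ tu ∷ [-]
      }
    , refl , here refl

  module _ (≇K₁,₁,₃ : ¬ (graph ≅ K₁,₁,₃)) where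

    -- This is the only obstructed shape: a 4-cycle `a b c d` with `a` and `c` in the part of the
    -- outside vertex `x`. The vertex `z` fits into the edge `ab` or `ad`.
    square-extends : ∀ {a b c d x} →
      Independent (x ∷ a ∷ c ∷ []) → Adj a b → Adj c b → Adj a d → Adj c d →
      Adj x b → Adj x d →
      ∃[ z ] z ∉ a ∷ b ∷ c ∷ d ∷ [] × Adj z a × (Adj z b ⊎ Adj z d)
    square-extends {a} {b} {c} {d} {x}
      ind@(((_ , ¬xa) ∷ _) ∷ ((_ , ¬ac) ∷ []) ∷ _)
      ab cb ad cd xb xd with adj? b d
    -- The third corner of a triangle on `ab` is not `c`, as `a` misses `c`, and not `d`, as `b`
    -- misses `d`.
    ... | no ¬bd with z , za , zb ← edge-in-triangle ab = z , z∉ , za , inj₁ zb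
      where
      z∉ : z ∉ a ∷ b ∷ c ∷ d ∷ []
      z∉ (here refl)                         = adj⇒≢ za refl
      z∉ (there (here refl))                 = adj⇒≢ zb refl
      z∉ (there (there (here refl)))         = ¬ac (adj-sym za)
      z∉ (there (there (there (here refl)))) = ¬bd (adj-sym zb)
    ... | yes bd with cover? (x ∷ a ∷ c ∷ b ∷ d ∷ [])
    -- A further vertex `y` sees an end of the edge `bd`; it sees `a`, since otherwise `y`, `x`,
    -- `a`, `c` would be four vertices in one part.
    ...   | inj₁ (y , y∉) = y , y∉′ , ya , M bd y
      where
      y∉′ : y ∉ a ∷ b ∷ c ∷ d ∷ []
      y∉′ (here e)                         = y∉ (there (here e))
      y∉′ (there (here e))                 = y∉ (there (there (there (here e))))
      y∉′ (there (there (here e)))         = y∉ (there (there (here e)))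
      y∉′ (there (there (there (here e)))) = y∉ (there (there (there (there (here e)))))

      ya : Adj y a
      ya with adj? y a
      ... | yes ya = ya
      ... | no ¬ya = contradiction
        (((y∉ ∘ here , ≁-trans ¬ya (¬xa ∘ adj-sym)) ∷
         (y∉ ∘ there ∘ here , ¬ya) ∷
         (y∉ ∘ there ∘ there ∘ here , ≁-trans ¬ya ¬ac) ∷ []) ∷ ind)
        (parts≤3 graph conn locConn free)
    -- With no further vertex, `b`, `d` and the independent set `x`, `a`, `c` make up the whole
    -- graph, which is then K₁,₁,₃.
    ...   | inj₂ all = contradiction (Embedding.surjective⇒≅ K₁,₁,₃↪ onto) ≇K₁,₁,₃
      where
      K₁,₁,₃↪ : Embedding K₁,₁,₃ graph
      K₁,₁,₃↪ = join (vertex b)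
        (join (vertex d) (independent ind) λ where
          0F 0F → adj-sym xd
          0F 1F → adj-sym ad
          0F 2F → adj-sym cd) λ where
        0F (inj₁ 0F) → bd
        0F (inj₂ 0F) → adj-sym xb
        0F (inj₂ 1F) → adj-sym ab
        0F (inj₂ 2F) → adj-sym cb

      onto : ∀ v → ∃[ i ] Embedding.apply K₁,₁,₃↪ i ≡ v
      onto v with all v
      ... | here e                                 = inj₂ (inj₂ 0F) , sym e
      ... | there (here e)                         = inj₂ (inj₂ 1F) , sym e
      ... | there (there (here e))                 = inj₂ (inj₂ 2F) , sym e
      ... | there (there (there (here e)))         = inj₁ 0F , sym e
      ... | there (there (there (there (here e)))) = inj₂ (inj₁ 0F) , sym e

    other-end-adj : ∀ {x u v} → Adj u v → ¬ Adj x u → Adj x v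
    other-end-adj uv ¬xu = [ (λ xu → contradiction xu ¬xu) , id ]′ (M uv _)

    nonadjacent-triple : ∀ {x u v} → x ≢ u → x ≢ v → u ≢ v → ¬ Adj x u → ¬ Adj x v →
             Independent (x ∷ u ∷ v ∷ [])
    nonadjacent-triple x≢u x≢v u≢v ¬xu ¬xv =
      ((x≢u , ¬xu) ∷ (x≢v , ¬xv) ∷ []) ∷ ((u≢v , ≁-trans (¬xu ∘ adj-sym) ¬xv) ∷ []) ∷ [] ∷ []

    no-nonadjacent-quadruple : ∀ {x u v w} → x ≢ u → x ≢ v → x ≢ w → u ≢ v → u ≢ w → v ≢ w →
                   ¬ Adj x u → ¬ Adj x v → ¬ Adj x w → ⊥
    no-nonadjacent-quadruple x≢u x≢v x≢w u≢v u≢w v≢w ¬xu ¬xv ¬xw = parts≤3 graph conn locConn free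
      (((x≢u , ¬xu) ∷ (x≢v , ¬xv) ∷ (x≢w , ¬xw) ∷ []) ∷
       ((u≢v , ≁-trans (¬xu ∘ adj-sym) ¬xv) ∷ (u≢w , ≁-trans (¬xu ∘ adj-sym) ¬xw) ∷ []) ∷
       ((v≢w , ≁-trans (¬xv ∘ adj-sym) ¬xw) ∷ []) ∷ [] ∷ [])

    -- By `NotBoth`, `x` never sees two consecutive vertices of the cycle; by `other-end-adj`, it
    -- never misses two. So adjacency to `x` alternates around the cycle, and the decision at `v₀`
    -- fixes the phase.
    obstruction⇒insertable : ∀ {x v₀ vs} → x ∉ v₀ ∷ vs → 3 ≤ length (v₀ ∷ vs) →
      Unique (v₀ ∷ vs) → Linked Adj (v₀ ∷ vs ∷ʳ v₀) → Linked (NotBoth x) (v₀ ∷ vs ∷ʳ v₀) →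
      Dec (Adj x v₀) → ∃[ z ] z ∉ v₀ ∷ vs × ¬ Linked (NotBoth z) (v₀ ∷ vs ∷ʳ v₀)
    obstruction⇒insertable {vs = []}          _ (s≤s ())       _ _ _ _
    obstruction⇒insertable {vs = _ ∷ []}      _ (s≤s (s≤s ())) _ _ _ _
    -- Alternation around a triangle fails by parity, in either phase.
    obstruction⇒insertable {vs = _ ∷ _ ∷ []} _ _ _ (e₀₁ ∷ e₁₂ ∷ e₂₀ ∷ [-]) (n₀₁ ∷ n₁₂ ∷ n₂₀ ∷ [-]) (no ¬x₀) =
      contradiction (other-end-adj e₂₀ (n₁₂ (other-end-adj e₀₁ ¬x₀))) ¬x₀
    obstruction⇒insertable {vs = _ ∷ _ ∷ []} _ _ _ (e₀₁ ∷ e₁₂ ∷ e₂₀ ∷ [-]) (n₀₁ ∷ n₁₂ ∷ n₂₀ ∷ [-]) (yes x₀) =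
      contradiction x₀ (n₂₀ (other-end-adj e₁₂ (n₀₁ x₀)))
    obstruction⇒insertable {vs = _ ∷ _ ∷ _ ∷ []} x∉ _
       ((_ ∷ v₀≢v₂ ∷ _) ∷ _)
       (e₀₁ ∷ e₁₂ ∷ e₂₃ ∷ e₃₀ ∷ [-]) (n₀₁ ∷ n₁₂ ∷ n₂₃ ∷ n₃₀ ∷ [-]) (no ¬x₀) =
      let x₁ = other-end-adj e₀₁ ¬x₀
          ¬x₂ = n₁₂ x₁
          x₃ = other-end-adj e₂₃ ¬x₂
          z , z∉ , z₀ , z₁⊎z₃ = square-extends
                 (nonadjacent-triple (x∉ ∘ here) (x∉ ∘ there ∘ there ∘ here) v₀≢v₂ ¬x₀ ¬x₂)
                 e₀₁ (adj-sym e₁₂) (adj-sym e₃₀) e₂₃ x₁ x₃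
      in z , z∉ , λ { (m₀₁ ∷ _ ∷ _ ∷ m₃₀ ∷ _) →
          [ m₀₁ z₀ , (λ z₃ → m₃₀ z₃ z₀) ]′ z₁⊎z₃ }
    obstruction⇒insertable {vs = _ ∷ _ ∷ _ ∷ []} x∉ _
       (_ ∷ (_ ∷ v₁≢v₃ ∷ _) ∷ _)
       (e₀₁ ∷ e₁₂ ∷ e₂₃ ∷ e₃₀ ∷ [-]) (n₀₁ ∷ n₁₂ ∷ n₂₃ ∷ n₃₀ ∷ [-]) (yes x₀) =
      let ¬x₁ = n₀₁ x₀
          x₂ = other-end-adj e₁₂ ¬x₁
          ¬x₃ = n₂₃ x₂
          z , z∉ , z₁ , z₂⊎z₀ = square-extends
                 (nonadjacent-triple (x∉ ∘ there ∘ here) (x∉ ∘ there ∘ there ∘ there ∘ here) v₁≢v₃ ¬x₁ ¬x₃)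
                 e₁₂ (adj-sym e₂₃) (adj-sym e₀₁) e₃₀ x₂ x₀
      -- In this phase the square is read from `v₁` as `v₁ v₂ v₃ v₀`, so the nonmembership of `z`
      -- has to be rotated back.
      in z , z∉ ∘ ∈-resp-↭ (∷↭∷ʳ _ (_ ∷ _ ∷ _ ∷ [])) , λ { (m₀₁ ∷ m₁₂ ∷ _) →
          [ m₁₂ z₁ , (λ z₀ → m₀₁ z₀ z₁) ]′ z₂⊎z₀ }
    -- From length 5 on, missing `v₀` means missing `v₂` and `v₄` too, which puts four vertices in
    -- one part. In the other phase this takes `v₁`, `v₃`, `v₅` and hence length 6, so length 5 is
    -- excluded by parity instead.
    obstruction⇒insertable {vs = _ ∷ _ ∷ _ ∷ _ ∷ _} x∉ _
       ((_ ∷ v₀≢v₂ ∷ _ ∷ v₀≢v₄ ∷ _) ∷ _ ∷ (_ ∷ v₂≢v₄ ∷ _) ∷ _)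
       (e₀₁ ∷ e₁₂ ∷ e₂₃ ∷ e₃₄ ∷ _) (n₀₁ ∷ n₁₂ ∷ n₂₃ ∷ n₃₄ ∷ _) (no ¬x₀) =
      contradiction ¬x₄
        (no-nonadjacent-quadruple (x∉ ∘ here) (x∉ ∘ there ∘ there ∘ here)
                      (x∉ ∘ there ∘ there ∘ there ∘ there ∘ here) v₀≢v₂ v₀≢v₄ v₂≢v₄ ¬x₀ ¬x₂)
      where
      ¬x₂ = n₁₂ (other-end-adj e₀₁ ¬x₀)
      ¬x₄ = n₃₄ (other-end-adj e₂₃ ¬x₂)
    obstruction⇒insertable {vs = _ ∷ _ ∷ _ ∷ _ ∷ []} _ _ _
       (e₀₁ ∷ e₁₂ ∷ e₂₃ ∷ e₃₄ ∷ e₄₀ ∷ [-]) (n₀₁ ∷ n₁₂ ∷ n₂₃ ∷ n₃₄ ∷ n₄₀ ∷ [-]) (yes x₀) =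
      contradiction x₀ (n₄₀ (other-end-adj e₃₄ (n₂₃ (other-end-adj e₁₂ (n₀₁ x₀)))))
    obstruction⇒insertable {vs = _ ∷ _ ∷ _ ∷ _ ∷ _ ∷ _} x∉ _
       (_ ∷ (_ ∷ v₁≢v₃ ∷ _ ∷ v₁≢v₅ ∷ _) ∷ _ ∷ (_ ∷ v₃≢v₅ ∷ _) ∷ _)
       (e₀₁ ∷ e₁₂ ∷ e₂₃ ∷ e₃₄ ∷ e₄₅ ∷ _) (n₀₁ ∷ n₁₂ ∷ n₂₃ ∷ n₃₄ ∷ n₄₅ ∷ _) (yes x₀) =
      contradiction ¬x₅
        (no-nonadjacent-quadruple (x∉ ∘ there ∘ here) (x∉ ∘ there ∘ there ∘ there ∘ here)
                      (x∉ ∘ there ∘ there ∘ there ∘ there ∘ there ∘ here)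
                      v₁≢v₃ v₁≢v₅ v₃≢v₅ ¬x₁ ¬x₃)
      where
      ¬x₁ = n₀₁ x₀
      ¬x₃ = n₂₃ (other-end-adj e₁₂ ¬x₁)
      ¬x₅ = n₄₅ (other-end-adj e₃₄ ¬x₃)

    -- Insertion is tried at most twice: if an arbitrary outside vertex `x` does not fit, its
    -- obstruction supplies an outside vertex `z` that cannot be obstructed.
    cycle-extends : ∀ (C : Cycle graph) → Cycle.size C < order → Extendable C
    cycle-extends C short with x , x∉ ← outside (Cycle.vertices C) short
      with insert⇒extendable C x∉
    ... | inj₁ ext     = ext
    ... | inj₂ notBoth
      with z , z∉ , insertable ← obstruction⇒insertable x∉ (Cycle.3≤size C)
                                   (Cycle.distinct C) (Cycle.closed C) notBoth (adj? x _)
      with insert⇒extendable C z∉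
    ...   | inj₁ ext      = ext
    ...   | inj₂ notBoth′ = contradiction notBoth′ insertable

theorem8 : (G : FiniteGraph) → let open FiniteGraph G in
    Connected graph →
    LocallyConnected graph →
    ((K 1 + P 4 ∷ K₁,₄ ∷ K 2 + (K 1 ∪ K 2) ∷ []) -free) graph →
    3 ≤ order →
    ¬ (graph ≅ K₁,₁,₃) →
    FullyCycleExtendable G
theorem8 G conn locConn free 3≤order ≇K₁,₁,₃ =
  on-triangle G conn locConn free 3≤order ,
  cycle-extends G conn locConn free 3≤order ≇K₁,₁,₃
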